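{- Let $\Phi$ be a CNF formula with $M$ clauses of three literals each, let $k$ be the number of its satisfying assignments, and let $f(x_1,\dots,x_{3M})$ be the reduced elementary algebraic expression of the identity relaxed logical formula of $\Phi$. Then the constant term of $f$ is $$\frac{1}{2^{3M}}\bigl(2k-2^{3M}\bigr).$$
   Context: Let $X_1,\dots,X_N$ be the variables of $\Phi$, each occurring $r_i\ge1$ times; $k$ is counted among the $2^N$ assignments of these variables. Number the literal occurrences $1,\dots,3M$ (clause $c$ consists of occurrences $3c-2,3c-1,3c$), replace the $a$-th occurrence (positive or negated) by a new variable $x_a$, let $x_{ij}$ be the new variable of the $j$-th occurrence of $X_i$, and $e_{ij}=1$ or $-1$ according to whether that occurrence is positive or negative. With true encoded as $1$ and false as $-1$, the identity relaxed logical formula is the conjunction of all clauses $x_{3c-2}\vee x_{3c-1}\vee x_{3c}$ and, for each $i$, of the formula asserting that the values $e_{ij}x_{ij}$ ($1\le j\le r_i$) are all true or all false. Its elementary algebraic expression is the polynomial $$\frac{1}{2^{6M-1}}\prod_{c=1}^{M}\bigl((x_{3c-2}-1)(x_{3c-1}-1)(x_{3c}-1)+8\bigr)\prod_{i=1}^{N}\Bigl(\prod_{j=1}^{r_i}(e_{ij}x_{ij}+1)+\prod_{j=1}^{r_i}(-e_{ij}x_{ij}+1)\Bigr)-1,$$ which takes on $\{ -1,1\}^{3M}$ the encoded truth values of the formula. The reduced elementary algebraic expression is the polynomial obtained by expanding this and replacing every $x_i^2$ by $1$. -}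

module Defs where

open import Algebra.Definitions.RawSemiring using () renaming (_^_ to pow)
open import Data.Bool using (Bool; true; false)
import Data.Bool.Properties as Bool
open import Data.Fin using (Fin; combine)
import Data.Fin.Properties as Fin
open import Data.Integer using (ℤ; +_; -[1+_]; _⊖_)
open import Data.List using (List; []; _∷_; [_]; _++_; map; foldr; filter; length; allFin; cartesianProductWith)
open import Data.Nat as ℕ using (ℕ; zero; suc)
open import Data.Nat.DivMod using (_%_)
import Data.Nat.Properties as ℕ
open import Data.Product using (_×_; _,_; proj₁; proj₂; map₂)
open import Data.Rational as ℚ using (ℚ; 0ℚ; 1ℚ; ½; +-*-rawSemiring)
open import Data.Vec as Vec using (Vec; []; _∷_; lookup; replicate; _[_]≔_)
import Data.Vec.Properties as Vec
open import Data.Vec.Relation.Unary.All as All using (All)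
open import Data.Vec.Relation.Unary.Any as Any using (Any)
open import Relation.Binary.PropositionalEquality using (_≡_)
open import Relation.Nullary using (Dec)

fromℤ : ℤ → ℚ
fromℤ z = z ℚ./ 1

infixr 9 2^_

2^_ : ℤ → ℚ
2^ (+ n)    = pow +-*-rawSemiring (fromℤ (+ 2)) n
2^ -[1+ n ] = pow +-*-rawSemiring ½ (suc n)

------------------------------------------------------------------------
-- Formulas

record Literal (N : ℕ) : Set where
  constructor literal
  field
    variableOf : Fin N
    positive   : Bool

open Literal public

Clause : ℕ → Set
Clause N = Vec (Literal N) 3

record CNF (M N : ℕ) : Set where
  field
    clauses : Vec (Clause N) M
    occurs  : ∀ i → Any (Any (λ ℓ → variableOf ℓ ≡ i)) clauses

open CNF public

Assignment : ℕ → Set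
Assignment = Vec Bool

Holds : ∀ {N} → Assignment N → Literal N → Set
Holds σ ℓ = lookup σ (variableOf ℓ) ≡ positive ℓ

Satisfies : ∀ {M N} → CNF M N → Assignment N → Set
Satisfies Φ σ = All (Any (Holds σ)) (clauses Φ)

satisfies? : ∀ {M N} (Φ : CNF M N) (σ : Assignment N) → Dec (Satisfies Φ σ)
satisfies? Φ σ =
  All.all? (Any.any? (λ ℓ → lookup σ (variableOf ℓ) Bool.≟ positive ℓ)) (clauses Φ)

assignments : ∀ N → List (Assignment N)
assignments zero    = [ [] ]
assignments (suc N) = cartesianProductWith _∷_ (true ∷ false ∷ []) (assignments N)

#satisfying : ∀ {M N} → CNF M N → ℕ
#satisfying {N = N} Φ = length (filter (satisfies? Φ) (assignments N))

-- Occurrences are numbered from 0, so clause c consists of the occurrences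
-- 3c, 3c+1, 3c+2, which are combine c 0, combine c 1, combine c 2.

occurrence : ∀ {M N} → CNF M N → Fin (M ℕ.* 3) → Literal N
occurrence Φ = lookup (Vec.concat (clauses Φ))

occurrencesOf : ∀ {M N} → CNF M N → Fin N → List (Fin (M ℕ.* 3))
occurrencesOf Φ i = filter (λ a → variableOf (occurrence Φ a) Fin.≟ i) (allFin _)

-- The conjunction of the clauses (disjunctions of new variables) and of the
-- groups, a group asserting that its literals are all true or all false.

record RelaxedFormula (M N : ℕ) : Set where
  field
    newClauses : Vec (Vec (Fin (M ℕ.* 3)) 3) M
    groups     : Vec (List (Literal (M ℕ.* 3))) N

open RelaxedFormula public

-- The literal on x_{ij} with the sign of the j-th occurrence of X_i is true
-- exactly when e_{ij} x_{ij} is.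

identityRelaxed : ∀ {M N} → CNF M N → RelaxedFormula M N
identityRelaxed Φ = record
  { newClauses = Vec.tabulate λ c → Vec.tabulate λ j → combine c j
  ; groups     = Vec.tabulate λ i →
      map (λ a → literal a (positive (occurrence Φ a))) (occurrencesOf Φ i)
  }

------------------------------------------------------------------------
-- Polynomials over ℚ in n variables

Monomial : ℕ → Set
Monomial = Vec ℕ

-- A formal sum of terms; a monomial may be listed several times, its
-- coefficient being the sum over all its listings.

Poly : ℕ → Set
Poly n = List (ℚ × Monomial n)

coefficient : ∀ {n} → Monomial n → Poly n → ℚ
coefficient m p =
  foldr ℚ._+_ 0ℚ (map proj₁ (filter (λ t → Vec.≡-dec ℕ._≟_ (proj₂ t) m) p))

constantTerm : ∀ {n} → Poly n → ℚ
constantTerm = coefficient (replicate _ 0)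

con : ∀ {n} → ℚ → Poly n
con q = [ q , replicate _ 0 ]

var : ∀ {n} → Fin n → Poly n
var i = [ 1ℚ , replicate _ 0 [ i ]≔ 1 ]

infixl 6 _⊕_
infixl 7 _⊗_

_⊕_ : ∀ {n} → Poly n → Poly n → Poly n
_⊕_ = _++_

_⊗_ : ∀ {n} → Poly n → Poly n → Poly n
_⊗_ = cartesianProductWith λ (a , m) (b , m′) → a ℚ.* b , Vec.zipWith ℕ._+_ m m′

∏ : ∀ {n} → List (Poly n) → Poly n
∏ = foldr _⊗_ (con 1ℚ)

-- Replacing every x_i² by 1 leaves x_i^e with e reduced modulo 2.

reduce : ∀ {n} → Poly n → Poly n
reduce = map (map₂ (Vec.map (_% 2)))

------------------------------------------------------------------------
-- Elementary algebraic expressions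

sign : Bool → ℚ
sign true  = 1ℚ
sign false = ℚ.- 1ℚ

signed : ∀ {n} → Literal n → Poly n
signed ℓ = con (sign (positive ℓ)) ⊗ var (variableOf ℓ)

clauseFactor : ∀ {n} → Vec (Fin n) 3 → Poly n
clauseFactor (a ∷ b ∷ c ∷ []) =
  (var a ⊕ con (ℚ.- 1ℚ)) ⊗ (var b ⊕ con (ℚ.- 1ℚ)) ⊗ (var c ⊕ con (ℚ.- 1ℚ))
    ⊕ con (fromℤ (+ 8))

groupFactor : ∀ {n} → List (Literal n) → Poly n
groupFactor ℓs =
  ∏ (map (λ ℓ → signed ℓ ⊕ con 1ℚ) ℓs)
    ⊕ ∏ (map (λ ℓ → con (ℚ.- 1ℚ) ⊗ signed ℓ ⊕ con 1ℚ) ℓs)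

-- The exponent of the leading factor 1 / 2^(6M-1) is an integer rather than a
-- natural number because M = 0 is allowed.

elementaryExpression : ∀ {M N} → RelaxedFormula M N → Poly (M ℕ.* 3)
elementaryExpression {M} R =
  con (2^ (1 ⊖ 6 ℕ.* M))
    ⊗ ∏ (Vec.toList (Vec.map clauseFactor (newClauses R)))
    ⊗ ∏ (Vec.toList (Vec.map groupFactor (groups R)))
    ⊕ con (ℚ.- 1ℚ)

reducedElementaryExpression : ∀ {M N} → RelaxedFormula M N → Poly (M ℕ.* 3)
reducedElementaryExpression R = reduce (elementaryExpression R)

-- For a polynomial p in n variables, the average of p over {-1,1}ⁿ is the
-- constant term of p reduced modulo xᵢ² = 1, since a squarefree monomial other
-- than 1 has average 0. For the elementary algebraic expression the average is
-- found by expanding ∏ᵢ (Pᵢ + Qᵢ) into a sum over the assignments σ of Φ: the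
-- summand of σ is a product of factors yₐxₐ + 1, one for each occurrence a,
-- where yₐ is the value under σ of the literal at a. It vanishes on {-1,1}³ᴹ
-- except at x = y, where it is 2³ᴹ and the product of the clause factors is 8ᴹ
-- or 0 according to whether σ satisfies Φ.

module Submission where

open import Defs
open import Algebra.Bundles using (CommutativeRing)
open import Algebra.Definitions.RawSemiring using () renaming (_^_ to pow)
import Algebra.Properties.CommutativeMonoid.Sum as CommutativeMonoidSum
import Algebra.Properties.Ring as RingProperties
import Algebra.Properties.Semiring.Exp as SemiringExp
open import Data.Bool using (Bool; true; false; if_then_else_; _∧_; _∨_)
import Data.Bool.Properties as Bool
open import Data.Fin using (Fin; zero; suc; combine)
import Data.Fin.Properties as Fin
open import Data.Integer using (+_; -_; _⊖_)
import Data.Integer as ℤ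
import Data.Integer.Properties as ℤ
open import Data.List using (List; []; _∷_; _++_; map; filter; length; allFin; tabulate; foldr)
import Data.List.Properties as List
open import Data.Nat using (ℕ; zero; suc; _*_)
import Data.Nat as ℕ
open import Data.Nat.DivMod using (_%_)
import Data.Nat.Properties as ℕ
open import Data.Product using (_×_; _,_)
open import Data.Rational using (ℚ; 0ℚ; 1ℚ; ½; _-_; _+_; +-*-rawSemiring; toℚᵘ)
  renaming (_*_ to _*ℚ_; -_ to -ℚ_)
import Data.Rational.Properties as ℚ
open import Data.Rational.Solver using (module +-*-Solver)
open import Data.Rational.Unnormalised as ℚᵘ using (mkℚᵘ; *≡*)
import Data.Rational.Unnormalised.Properties as ℚᵘ
open import Data.Sum using (_⊎_; inj₁; inj₂)
open import Data.Vec using (Vec; []; _∷_; lookup; replicate; _[_]≔_)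
import Data.Vec as Vec
import Data.Vec.Properties as Vec
open import Data.Vec.Relation.Unary.All using (all?)
open import Data.Vec.Relation.Unary.Any using (any?)
open import Function using (_∘_)
open import Level using (0ℓ)
open import Relation.Binary.PropositionalEquality
  using (_≡_; _≗_; refl; sym; trans; cong; cong₂; module ≡-Reasoning)
open import Relation.Nullary using (does)
open import Relation.Unary using (Pred; Decidable)

open ≡-Reasoning
open +-*-Solver using (solve; _:=_; _:+_; _:*_) renaming (con to κ)
open CommutativeMonoidSum ℚ.*-1-commutativeMonoid using ()
  renaming (sum to ∏ᶠ; sum-cong-≗ to ∏ᶠ-cong; ∑-distrib-+ to ∏ᶠ-distrib-*)
open RingProperties (CommutativeRing.ring ℚ.+-*-commutativeRing) using (-1*x≈-x)
open SemiringExp (CommutativeRing.semiring ℚ.+-*-commutativeRing) using (^-homo-*)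

-- Rational arithmetic and integer powers of two

*-swap : ∀ a b c → a *ℚ (b *ℚ c) ≡ b *ℚ (a *ℚ c)
*-swap = solve 3 (λ a b c → a :* (b :* c) := b :* (a :* c)) refl

*-interchange : ∀ a b c d → (a *ℚ b) *ℚ (c *ℚ d) ≡ (a *ℚ c) *ℚ (b *ℚ d)
*-interchange = solve 4 (λ a b c d → (a :* b) :* (c :* d) := (a :* c) :* (b :* d)) refl

+-interchange : ∀ a b c d → (a + b) + (c + d) ≡ (a + c) + (b + d)
+-interchange = solve 4 (λ a b c d → (a :+ b) :+ (c :+ d) := (a :+ c) :+ (b :+ d)) refl

-- Addition in `ℚ` normalises its result, so the two sides do not compute to a common form for
-- variable `i` and `j`. In the unnormalised rationals both are fractions over 1 and only integer
-- arithmetic remains.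
fromℤ-+ : ∀ i j → fromℤ (i ℤ.+ j) ≡ fromℤ i + fromℤ j
fromℤ-+ i j = ℚ.toℚᵘ-injective (begin-equality
  toℚᵘ (fromℤ (i ℤ.+ j))                ≃⟨ ℚ.toℚᵘ-fromℚᵘ (mkℚᵘ (i ℤ.+ j) 0) ⟩
  mkℚᵘ (i ℤ.+ j) 0                      ≃⟨ *≡* (cong (ℤ._* ℤ.1ℤ) (cong₂ ℤ._+_ (sym (ℤ.*-identityʳ i)) (sym (ℤ.*-identityʳ j)))) ⟩
  mkℚᵘ i 0 ℚᵘ.+ mkℚᵘ j 0                ≃⟨ ℚᵘ.+-cong (ℚ.toℚᵘ-fromℚᵘ (mkℚᵘ i 0)) (ℚ.toℚᵘ-fromℚᵘ (mkℚᵘ j 0)) ⟨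
  toℚᵘ (fromℤ i) ℚᵘ.+ toℚᵘ (fromℤ j)    ≃⟨ ℚ.toℚᵘ-homo-+ (fromℤ i) (fromℤ j) ⟨
  toℚᵘ (fromℤ i + fromℤ j)              ∎ᵘ)
  where open ℚᵘ.≤-Reasoning using (begin-equality_; step-≃-⟩; step-≃-⟨) renaming (_∎ to _∎ᵘ)

2^-⊖ : ∀ m n → 2^ (m ⊖ n) *ℚ 2^ (+ n) ≡ 2^ (+ m)
2^-⊖ m       zero    = ℚ.*-identityʳ (2^ (+ m))
-- Here `zero ⊖ suc n` computes to `-[1+ n ]`, so the first factor is a power of `½`.
2^-⊖ zero    (suc n) = inv (suc n)
  where
  inv : ∀ k → pow +-*-rawSemiring ½ k *ℚ 2^ (+ k) ≡ 1ℚ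
  inv zero    = refl
  inv (suc k) = trans (*-interchange ½ (pow +-*-rawSemiring ½ k) (fromℤ (+ 2)) (2^ (+ k))) (trans (ℚ.*-identityˡ _) (inv k))
2^-⊖ (suc m) (suc n) = begin
  2^ (suc m ⊖ suc n) *ℚ 2^ (+ suc n)  ≡⟨ cong (λ z → 2^ z *ℚ 2^ (+ suc n)) (ℤ.[1+m]⊖[1+n]≡m⊖n m n) ⟩
  2^ (m ⊖ n) *ℚ 2^ (+ suc n)          ≡⟨ *-swap (2^ (m ⊖ n)) (fromℤ (+ 2)) (2^ (+ n)) ⟩
  fromℤ (+ 2) *ℚ (2^ (m ⊖ n) *ℚ 2^ (+ n)) ≡⟨ cong (fromℤ (+ 2) *ℚ_) (2^-⊖ m n) ⟩
  2^ (+ suc m)                        ∎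

2^-+ : ∀ m n → 2^ (+ (m ℕ.+ n)) ≡ 2^ (+ m) *ℚ 2^ (+ n)
2^-+ = ^-homo-* (fromℤ (+ 2))

𝟙 : Bool → ℚ
𝟙 true  = 1ℚ
𝟙 false = 0ℚ

𝟙-∧ : ∀ a b → 𝟙 (a ∧ b) ≡ 𝟙 a *ℚ 𝟙 b
𝟙-∧ true  b = sym (ℚ.*-identityˡ (𝟙 b))
𝟙-∧ false b = sym (ℚ.*-zeroˡ (𝟙 b))

-- Sums over all assignments

-- Recursion on the first coordinate lets sums split along with products indexed by `Fin`. The same
-- sum serves for the truth assignments of a formula and, through `sign`, for the points with
-- coordinates ±1.
∑ : ∀ {n} → (Assignment n → ℚ) → ℚ
∑ {zero}  f = f []
∑ {suc n} f = ∑ (λ x → f (true ∷ x)) + ∑ (λ x → f (false ∷ x))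

∑-cong : ∀ {n} {f g : Assignment n → ℚ} → f ≗ g → ∑ f ≡ ∑ g
∑-cong {zero}  f≗g = f≗g []
∑-cong {suc n} f≗g = cong₂ _+_ (∑-cong (f≗g ∘ (true ∷_))) (∑-cong (f≗g ∘ (false ∷_)))

∑-+ : ∀ {n} (f g : Assignment n → ℚ) → ∑ (λ x → f x + g x) ≡ ∑ f + ∑ g
∑-+ {zero}  f g = refl
∑-+ {suc n} f g = trans
  (cong₂ _+_ (∑-+ (f ∘ (true ∷_)) (g ∘ (true ∷_))) (∑-+ (f ∘ (false ∷_)) (g ∘ (false ∷_))))
  (+-interchange (∑ (f ∘ (true ∷_))) _ _ _)

∑-*ˡ : ∀ {n} c (f : Assignment n → ℚ) → ∑ (λ x → c *ℚ f x) ≡ c *ℚ ∑ f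
∑-*ˡ {zero}  c f = refl
∑-*ˡ {suc n} c f = trans
  (cong₂ _+_ (∑-*ˡ c (f ∘ (true ∷_))) (∑-*ˡ c (f ∘ (false ∷_))))
  (sym (ℚ.*-distribˡ-+ c _ _))

∑-const : ∀ n c → ∑ {n} (λ _ → c) ≡ 2^ (+ n) *ℚ c
∑-const zero    c = sym (ℚ.*-identityˡ c)
∑-const (suc n) c = trans (cong₂ _+_ (∑-const n c) (∑-const n c)) (double (2^ (+ n)) c)
  where
  double : ∀ p c → p *ℚ c + p *ℚ c ≡ (fromℤ (+ 2) *ℚ p) *ℚ c
  double = solve 2 (λ p c → p :* c :+ p :* c := (κ (fromℤ (+ 2)) :* p) :* c) refl

∑-swap : ∀ {m n} (f : Assignment m → Assignment n → ℚ) →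
  ∑ (λ x → ∑ (λ y → f x y)) ≡ ∑ (λ y → ∑ (λ x → f x y))
∑-swap {zero}  f = refl
∑-swap {suc m} f = trans
  (cong₂ _+_ (∑-swap (f ∘ (true ∷_))) (∑-swap (f ∘ (false ∷_))))
  (sym (∑-+ (λ y → ∑ (λ x → f (true ∷ x) y)) (λ y → ∑ (λ x → f (false ∷ x) y))))

length-filter-map : ∀ {A B : Set} {P : Pred B 0ℓ} (P? : Decidable P) (f : A → B) xs →
  length (filter P? (map f xs)) ≡ length (filter (P? ∘ f) xs)
length-filter-map P? f [] = refl
length-filter-map P? f (x ∷ xs) with does (P? (f x))
... | true  = cong suc (length-filter-map P? f xs)
... | false = length-filter-map P? f xs

#-as-∑ : ∀ n {P : Pred (Assignment n) 0ℓ} (P? : Decidable P) →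
  fromℤ (+ length (filter P? (assignments n))) ≡ ∑ (λ x → 𝟙 (does (P? x)))
#-as-∑ zero P? with does (P? [])
... | true  = refl
... | false = refl
#-as-∑ (suc n) P? = begin
  fromℤ (+ length (filter P? (map (true ∷_) xs ++ map (false ∷_) xs ++ [])))
    -- `cartesianProductWith` ends with an empty list after the block for `false`; it is dropped so
    -- that exactly two blocks remain.
    ≡⟨ cong (λ ys → fromℤ (+ length (filter P? (map (true ∷_) xs ++ ys)))) (List.++-identityʳ _) ⟩
  fromℤ (+ length (filter P? (map (true ∷_) xs ++ map (false ∷_) xs)))
    ≡⟨ cong (λ ys → fromℤ (+ length ys)) (List.filter-++ P? (map (true ∷_) xs) _) ⟩
  fromℤ (+ length (filter P? (map (true ∷_) xs) ++ filter P? (map (false ∷_) xs)))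
    ≡⟨ cong (fromℤ ∘ +_) (List.length-++ (filter P? (map (true ∷_) xs))) ⟩
  fromℤ (+ (length (filter P? (map (true ∷_) xs)) ℕ.+ length (filter P? (map (false ∷_) xs))))
    ≡⟨ fromℤ-+ (+ length (filter P? (map (true ∷_) xs))) (+ length (filter P? (map (false ∷_) xs))) ⟩
  fromℤ (+ length (filter P? (map (true ∷_) xs))) + fromℤ (+ length (filter P? (map (false ∷_) xs)))
    ≡⟨ cong₂ _+_ (step true) (step false) ⟩
  ∑ (λ x → 𝟙 (does (P? x)))
    ∎
  where
  xs = assignments n
  step : ∀ b → fromℤ (+ length (filter P? (map (b ∷_) xs))) ≡ ∑ (λ x → 𝟙 (does (P? (b ∷ x))))
  step b = trans (cong (fromℤ ∘ +_) (length-filter-map P? (b ∷_) xs)) (#-as-∑ n (P? ∘ (b ∷_)))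

-- Finite products

product : List ℚ → ℚ
product = foldr _*ℚ_ 1ℚ

∏ᶠ-1 : ∀ n → ∏ᶠ {n} (λ _ → 1ℚ) ≡ 1ℚ
∏ᶠ-1 zero    = refl
∏ᶠ-1 (suc n) = trans (ℚ.*-identityˡ _) (∏ᶠ-1 n)

∏ᶠ-select : ∀ {n} (i : Fin n) (h : Fin n → ℚ) →
  ∏ᶠ (λ j → if does (i Fin.≟ j) then h j else 1ℚ) ≡ h i
∏ᶠ-select {suc n} zero h = trans (cong (h zero *ℚ_) (∏ᶠ-1 n)) (ℚ.*-identityʳ _)
∏ᶠ-select {suc n} (suc i) h = trans (ℚ.*-identityˡ _) (∏ᶠ-select i (h ∘ suc))

-- Every `a` lies in exactly one fibre of `v`. Adding `a` to the list therefore changes the product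
-- of a single fibre, the one over `v a`, and multiplies every other one by 1.
∏ᶠ-fibres : ∀ {A : Set} {n} (v : A → Fin n) (g : Fin n → A → ℚ) as →
  ∏ᶠ (λ i → product (map (g i) (filter (λ a → v a Fin.≟ i) as)))
    ≡ product (map (λ a → g (v a) a) as)
∏ᶠ-fibres {n = n} v g [] = ∏ᶠ-1 n
∏ᶠ-fibres v g (a ∷ as) = begin
  ∏ᶠ (λ i → product (map (g i) (filter (λ a → v a Fin.≟ i) (a ∷ as))))
    ≡⟨ ∏ᶠ-cong split ⟩
  ∏ᶠ (λ i → (if does (v a Fin.≟ i) then g i a else 1ℚ) *ℚ fibre i)
    ≡⟨ ∏ᶠ-distrib-* (λ i → if does (v a Fin.≟ i) then g i a else 1ℚ) fibre ⟩
  ∏ᶠ (λ i → if does (v a Fin.≟ i) then g i a else 1ℚ) *ℚ ∏ᶠ fibre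
    ≡⟨ cong₂ _*ℚ_ (∏ᶠ-select (v a) (λ i → g i a)) (∏ᶠ-fibres v g as) ⟩
  g (v a) a *ℚ product (map (λ a → g (v a) a) as)
    ∎
  where
  fibre : _ → ℚ
  fibre i = product (map (g i) (filter (λ a → v a Fin.≟ i) as))
  split : ∀ i → product (map (g i) (filter (λ a → v a Fin.≟ i) (a ∷ as)))
              ≡ (if does (v a Fin.≟ i) then g i a else 1ℚ) *ℚ fibre i
  split i with does (v a Fin.≟ i)
  ... | true  = refl
  ... | false = sym (ℚ.*-identityˡ _)

product-allFin : ∀ {n} (g : Fin n → ℚ) → product (map g (allFin n)) ≡ ∏ᶠ g
product-allFin g = trans (cong product (List.map-tabulate (λ i → i) g)) (product-tabulate g)
  where
  product-tabulate : ∀ {n} (g : Fin n → ℚ) → product (tabulate g) ≡ ∏ᶠ g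
  product-tabulate {zero}  g = refl
  product-tabulate {suc n} g = cong (g zero *ℚ_) (product-tabulate (g ∘ suc))

-- Distributivity: expanding the product means choosing one of two summands in each factor, and the
-- choices are recorded as an assignment `σ`.
∏ᶠ-+ : ∀ {n} (g : Bool → Fin n → ℚ) →
  ∏ᶠ (λ i → g true i + g false i) ≡ ∑ (λ σ → ∏ᶠ (λ i → g (lookup σ i) i))
∏ᶠ-+ {zero}  g = refl
∏ᶠ-+ {suc n} g = begin
  (g true zero + g false zero) *ℚ ∏ᶠ (λ i → g true (suc i) + g false (suc i))
    ≡⟨ cong ((g true zero + g false zero) *ℚ_) (∏ᶠ-+ (λ b → g b ∘ suc)) ⟩
  (g true zero + g false zero) *ℚ ∑ rest
    ≡⟨ ℚ.*-distribʳ-+ (∑ rest) (g true zero) (g false zero) ⟩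
  g true zero *ℚ ∑ rest + g false zero *ℚ ∑ rest
    ≡⟨ cong₂ _+_ (∑-*ˡ (g true zero) rest) (∑-*ˡ (g false zero) rest) ⟨
  ∑ (λ σ → ∏ᶠ (λ i → g (lookup σ i) i))
    ∎
  where
  rest : Assignment n → ℚ
  rest σ = ∏ᶠ (λ i → g (lookup σ i) (suc i))

-- On ±1-points, ∏ₐ (yₐxₐ + 1) is 2ⁿ if x = y and 0 otherwise.
∑-delta : ∀ {n} (C : Assignment n → ℚ) (y : Assignment n) →
  ∑ (λ x → C x *ℚ ∏ᶠ (λ a → sign (lookup y a) *ℚ sign (lookup x a) + 1ℚ)) ≡ 2^ (+ n) *ℚ C y
∑-delta {zero}  C []      = trans (ℚ.*-identityʳ (C [])) (sym (ℚ.*-identityˡ (C [])))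
∑-delta {suc n} C (b ∷ y) = begin
  branch true + branch false
    ≡⟨ cong₂ _+_ (factor true) (factor false) ⟩
  (sign b *ℚ sign true + 1ℚ) *ℚ (2^ (+ n) *ℚ C (true ∷ y))
    + (sign b *ℚ sign false + 1ℚ) *ℚ (2^ (+ n) *ℚ C (false ∷ y))
    ≡⟨ collapse b (2^ (+ n)) (λ b → C (b ∷ y)) ⟩
  2^ (+ suc n) *ℚ C (b ∷ y)
    ∎
  where
  δ : Assignment n → ℚ
  δ x = ∏ᶠ (λ a → sign (lookup y a) *ℚ sign (lookup x a) + 1ℚ)
  branch : Bool → ℚ
  branch b′ = ∑ (λ x → C (b′ ∷ x) *ℚ ((sign b *ℚ sign b′ + 1ℚ) *ℚ δ x))
  factor : ∀ b′ → branch b′ ≡ (sign b *ℚ sign b′ + 1ℚ) *ℚ (2^ (+ n) *ℚ C (b′ ∷ y))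
  factor b′ = begin
    branch b′
      ≡⟨ ∑-cong (λ x → *-swap (C (b′ ∷ x)) (sign b *ℚ sign b′ + 1ℚ) (δ x)) ⟩
    ∑ (λ x → (sign b *ℚ sign b′ + 1ℚ) *ℚ (C (b′ ∷ x) *ℚ δ x))
      ≡⟨ ∑-*ˡ (sign b *ℚ sign b′ + 1ℚ) (λ x → C (b′ ∷ x) *ℚ δ x) ⟩
    (sign b *ℚ sign b′ + 1ℚ) *ℚ ∑ (λ x → C (b′ ∷ x) *ℚ δ x)
      ≡⟨ cong ((sign b *ℚ sign b′ + 1ℚ) *ℚ_) (∑-delta (C ∘ (b′ ∷_)) y) ⟩
    (sign b *ℚ sign b′ + 1ℚ) *ℚ (2^ (+ n) *ℚ C (b′ ∷ y))
      ∎
  -- Of the two coefficients, the one whose sign agrees with `sign b` is 2 and the other is 0.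
  collapse : ∀ b p (c : Bool → ℚ) →
    (sign b *ℚ sign true + 1ℚ) *ℚ (p *ℚ c true) + (sign b *ℚ sign false + 1ℚ) *ℚ (p *ℚ c false)
      ≡ (fromℤ (+ 2) *ℚ p) *ℚ c b
  collapse true p c = solve 3 (λ p s t → κ (fromℤ (+ 2)) :* (p :* s) :+ κ 0ℚ :* (p :* t)
    := (κ (fromℤ (+ 2)) :* p) :* s) refl p (c true) (c false)
  collapse false p c = solve 3 (λ p s t → κ 0ℚ :* (p :* s) :+ κ (fromℤ (+ 2)) :* (p :* t)
    := (κ (fromℤ (+ 2)) :* p) :* t) refl p (c true) (c false)

-- Evaluation at ±1-points

evalMonomial : ∀ {n} → Assignment n → Monomial n → ℚ
evalMonomial []      []      = 1ℚ
evalMonomial (b ∷ x) (e ∷ m) = pow +-*-rawSemiring (sign b) e *ℚ evalMonomial x m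

eval : ∀ {n} → Assignment n → Poly n → ℚ
eval x []            = 0ℚ
eval x ((q , m) ∷ p) = q *ℚ evalMonomial x m + eval x p

evalMonomial-0 : ∀ {n} (x : Assignment n) → evalMonomial x (replicate n 0) ≡ 1ℚ
evalMonomial-0 []      = refl
evalMonomial-0 (b ∷ x) = trans (ℚ.*-identityˡ _) (evalMonomial-0 x)

evalMonomial-+ : ∀ {n} (x : Assignment n) (m m′ : Monomial n) →
  evalMonomial x (Vec.zipWith ℕ._+_ m m′) ≡ evalMonomial x m *ℚ evalMonomial x m′
evalMonomial-+ []      []      []        = refl
evalMonomial-+ (b ∷ x) (e ∷ m) (e′ ∷ m′) = trans
  (cong₂ _*ℚ_ (^-homo-* (sign b) e e′) (evalMonomial-+ x m m′))
  (*-interchange (pow +-*-rawSemiring (sign b) e) (pow +-*-rawSemiring (sign b) e′) _ _)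

eval-con : ∀ {n} (x : Assignment n) q → eval x (con q) ≡ q
eval-con x q = begin
  q *ℚ evalMonomial x (replicate _ 0) + 0ℚ  ≡⟨ ℚ.+-identityʳ _ ⟩
  q *ℚ evalMonomial x (replicate _ 0)       ≡⟨ cong (q *ℚ_) (evalMonomial-0 x) ⟩
  q *ℚ 1ℚ                                   ≡⟨ ℚ.*-identityʳ q ⟩
  q                                         ∎

eval-var : ∀ {n} (x : Assignment n) i → eval x (var i) ≡ sign (lookup x i)
eval-var x i = trans (ℚ.+-identityʳ _) (trans (ℚ.*-identityˡ _) (monomial x i))
  where
  monomial : ∀ {n} (x : Assignment n) i →
    evalMonomial x (replicate n 0 [ i ]≔ 1) ≡ sign (lookup x i)
  monomial (b ∷ x) zero    = trans
    (cong₂ _*ℚ_ (ℚ.*-identityʳ (sign b)) (evalMonomial-0 x)) (ℚ.*-identityʳ (sign b))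
  monomial (b ∷ x) (suc i) = trans (ℚ.*-identityˡ _) (monomial x i)

eval-⊕ : ∀ {n} (x : Assignment n) p q → eval x (p ⊕ q) ≡ eval x p + eval x q
eval-⊕ x []            q = sym (ℚ.+-identityˡ (eval x q))
eval-⊕ x ((a , m) ∷ p) q = trans
  (cong (λ r → a *ℚ evalMonomial x m + r) (eval-⊕ x p q))
  (sym (ℚ.+-assoc (a *ℚ evalMonomial x m) (eval x p) (eval x q)))

eval-⊗ : ∀ {n} (x : Assignment n) p q → eval x (p ⊗ q) ≡ eval x p *ℚ eval x q
eval-⊗ x []            q = sym (ℚ.*-zeroˡ (eval x q))
eval-⊗ x ((a , m) ∷ p) q = begin
  eval x (map term q ++ p ⊗ q)                            ≡⟨ eval-⊕ x (map term q) (p ⊗ q) ⟩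
  eval x (map term q) + eval x (p ⊗ q)                    ≡⟨ cong₂ _+_ (eval-term q) (eval-⊗ x p q) ⟩
  a *ℚ evalMonomial x m *ℚ eval x q + eval x p *ℚ eval x q ≡⟨ ℚ.*-distribʳ-+ (eval x q) (a *ℚ evalMonomial x m) (eval x p) ⟨
  (a *ℚ evalMonomial x m + eval x p) *ℚ eval x q          ∎
  where
  term : ℚ × Monomial _ → ℚ × Monomial _
  term (b , m′) = a *ℚ b , Vec.zipWith ℕ._+_ m m′
  eval-term : ∀ q → eval x (map term q) ≡ a *ℚ evalMonomial x m *ℚ eval x q
  eval-term []             = sym (ℚ.*-zeroʳ (a *ℚ evalMonomial x m))
  eval-term ((b , m′) ∷ q) = begin
    a *ℚ b *ℚ evalMonomial x (Vec.zipWith ℕ._+_ m m′) + eval x (map term q)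
      ≡⟨ cong₂ (λ u v → a *ℚ b *ℚ u + v) (evalMonomial-+ x m m′) (eval-term q) ⟩
    a *ℚ b *ℚ (evalMonomial x m *ℚ evalMonomial x m′) + a *ℚ evalMonomial x m *ℚ eval x q
      ≡⟨ cong (_+ a *ℚ evalMonomial x m *ℚ eval x q) (*-interchange a b (evalMonomial x m) (evalMonomial x m′)) ⟩
    a *ℚ evalMonomial x m *ℚ (b *ℚ evalMonomial x m′) + a *ℚ evalMonomial x m *ℚ eval x q
      ≡⟨ ℚ.*-distribˡ-+ (a *ℚ evalMonomial x m) (b *ℚ evalMonomial x m′) (eval x q) ⟨
    a *ℚ evalMonomial x m *ℚ (b *ℚ evalMonomial x m′ + eval x q)
      ∎

eval-∏-map : ∀ {n} {A : Set} (x : Assignment n) (F : A → Poly n) as →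
  eval x (∏ (map F as)) ≡ product (map (eval x ∘ F) as)
eval-∏-map x F []       = eval-con x 1ℚ
eval-∏-map x F (a ∷ as) = trans
  (eval-⊗ x (F a) (∏ (map F as))) (cong (eval x (F a) *ℚ_) (eval-∏-map x F as))

eval-∏-tabulate : ∀ {n k} {A : Set} (x : Assignment n) (F : A → Poly n) (G : Fin k → A) →
  eval x (∏ (Vec.toList (Vec.map F (Vec.tabulate G)))) ≡ ∏ᶠ (λ i → eval x (F (G i)))
eval-∏-tabulate {k = zero}  x F G = eval-con x 1ℚ
eval-∏-tabulate {k = suc k} x F G = trans
  (eval-⊗ x (F (G zero)) (∏ (Vec.toList (Vec.map F (Vec.tabulate (G ∘ suc))))))
  (cong (eval x (F (G zero)) *ℚ_) (eval-∏-tabulate x F (G ∘ suc)))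

sign-involutive : ∀ b q → sign b *ℚ (sign b *ℚ q) ≡ q
sign-involutive true  q = trans (ℚ.*-identityˡ _) (ℚ.*-identityˡ q)
sign-involutive false q = trans (sym (ℚ.*-assoc (sign false) (sign false) q)) (ℚ.*-identityˡ q)

-- Since the square of ±1 is 1, only the parity of the exponent matters; this is why `reduce` leaves
-- values at ±1-points unchanged.
pow-sign-%2 : ∀ b e → pow +-*-rawSemiring (sign b) (e % 2) ≡ pow +-*-rawSemiring (sign b) e
pow-sign-%2 b 0             = refl
pow-sign-%2 b 1             = refl
-- `suc (suc e) % 2` computes to `e % 2`, so the induction goes down by two.
pow-sign-%2 b (suc (suc e)) = trans (pow-sign-%2 b e) (sym (sign-involutive b _))

evalMonomial-%2 : ∀ {n} (x : Assignment n) m →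
  evalMonomial x (Vec.map (_% 2) m) ≡ evalMonomial x m
evalMonomial-%2 []      []      = refl
evalMonomial-%2 (b ∷ x) (e ∷ m) = cong₂ _*ℚ_ (pow-sign-%2 b e) (evalMonomial-%2 x m)

eval-reduce : ∀ {n} (x : Assignment n) p → eval x (reduce p) ≡ eval x p
eval-reduce x []            = refl
eval-reduce x ((q , m) ∷ p) =
  cong₂ (λ u v → q *ℚ u + v) (evalMonomial-%2 x m) (eval-reduce x p)

-- The constant term of a reduced polynomial as an average

isConstant : ∀ {n} → Monomial n → Bool
isConstant m = does (Vec.≡-dec ℕ._≟_ m (replicate _ 0))

-- Replaces the filter in `coefficient` by a weight 0 or 1, which makes the constant term visibly
-- linear in the list of terms.
constantTerm-∷ : ∀ {n} q (m : Monomial n) p →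
  constantTerm ((q , m) ∷ p) ≡ q *ℚ 𝟙 (isConstant m) + constantTerm p
constantTerm-∷ q m p with isConstant m
... | true  = cong (_+ constantTerm p) (sym (ℚ.*-identityʳ q))
... | false = sym (trans (cong (_+ constantTerm p) (ℚ.*-zeroʳ q)) (ℚ.+-identityˡ _))

%2-cases : ∀ e → e % 2 ≡ 0 ⊎ e % 2 ≡ 1
%2-cases 0             = inj₁ refl
%2-cases 1             = inj₂ refl
%2-cases (suc (suc e)) = %2-cases e

-- The sum factors over the coordinates. Exponent 0 contributes 1 + 1 = 2 and exponent 1 contributes
-- 1 - 1 = 0, so one odd exponent annihilates the whole sum.
∑-evalMonomial : ∀ {n} (m : Monomial n) →
  ∑ (λ x → evalMonomial x (Vec.map (_% 2) m)) ≡ 2^ (+ n) *ℚ 𝟙 (isConstant (Vec.map (_% 2) m))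
∑-evalMonomial []            = refl
∑-evalMonomial {suc n} (e ∷ m) = begin
  ∑ (λ x → pow′ true *ℚ f x) + ∑ (λ x → pow′ false *ℚ f x)
    ≡⟨ cong₂ _+_ (∑-*ˡ (pow′ true) f) (∑-*ˡ (pow′ false) f) ⟩
  pow′ true *ℚ ∑ f + pow′ false *ℚ ∑ f
    ≡⟨ ℚ.*-distribʳ-+ (∑ f) (pow′ true) (pow′ false) ⟨
  (pow′ true + pow′ false) *ℚ ∑ f
    ≡⟨ cong ((pow′ true + pow′ false) *ℚ_) (∑-evalMonomial m) ⟩
  (pow′ true + pow′ false) *ℚ (2^ (+ n) *ℚ 𝟙 (isConstant (Vec.map (_% 2) m)))
    ≡⟨ parity (%2-cases e) ⟩
  2^ (+ suc n) *ℚ 𝟙 (isConstant (Vec.map (_% 2) (e ∷ m)))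
    ∎
  where
  pow′ : Bool → ℚ
  pow′ b = pow +-*-rawSemiring (sign b) (e % 2)
  f : Assignment n → ℚ
  f x = evalMonomial x (Vec.map (_% 2) m)
  parity : e % 2 ≡ 0 ⊎ e % 2 ≡ 1 →
    (pow′ true + pow′ false) *ℚ (2^ (+ n) *ℚ 𝟙 (isConstant (Vec.map (_% 2) m)))
      ≡ 2^ (+ suc n) *ℚ 𝟙 (isConstant (Vec.map (_% 2) (e ∷ m)))
  parity (inj₁ eq) rewrite eq = sym (ℚ.*-assoc (fromℤ (+ 2)) (2^ (+ n)) _)
  parity (inj₂ eq) rewrite eq = trans (ℚ.*-zeroˡ (2^ (+ n) *ℚ 𝟙 (isConstant (Vec.map (_% 2) m)))) (sym (ℚ.*-zeroʳ (2^ (+ suc n))))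

-- By linearity it suffices to treat single terms. Passing to `reduce p` first brings all exponents
-- to 0 or 1, as the sum over a monomial requires.
∑-eval : ∀ {n} (p : Poly n) →
  ∑ (λ x → eval x p) ≡ 2^ (+ n) *ℚ constantTerm (reduce p)
∑-eval {n} p = trans (∑-cong (λ x → sym (eval-reduce x p))) (go p)
  where
  go : ∀ p → ∑ (λ x → eval x (reduce p)) ≡ 2^ (+ n) *ℚ constantTerm (reduce p)
  go []            = ∑-const n 0ℚ
  go ((q , m) ∷ p) = begin
    ∑ (λ x → q *ℚ evalMonomial x m′ + eval x (reduce p))
      ≡⟨ ∑-+ (λ x → q *ℚ evalMonomial x m′) (λ x → eval x (reduce p)) ⟩
    ∑ (λ x → q *ℚ evalMonomial x m′) + ∑ (λ x → eval x (reduce p))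
      ≡⟨ cong₂ _+_ (trans (∑-*ˡ q (λ x → evalMonomial x m′)) (cong (q *ℚ_) (∑-evalMonomial m))) (go p) ⟩
    q *ℚ (2^ (+ n) *ℚ 𝟙 (isConstant m′)) + 2^ (+ n) *ℚ constantTerm (reduce p)
      ≡⟨ cong (_+ 2^ (+ n) *ℚ constantTerm (reduce p)) (*-swap q (2^ (+ n)) (𝟙 (isConstant m′))) ⟩
    2^ (+ n) *ℚ (q *ℚ 𝟙 (isConstant m′)) + 2^ (+ n) *ℚ constantTerm (reduce p)
      ≡⟨ ℚ.*-distribˡ-+ (2^ (+ n)) (q *ℚ 𝟙 (isConstant m′)) (constantTerm (reduce p)) ⟨
    2^ (+ n) *ℚ (q *ℚ 𝟙 (isConstant m′) + constantTerm (reduce p))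
      ≡⟨ cong (2^ (+ n) *ℚ_) (constantTerm-∷ q m′ (reduce p)) ⟨
    2^ (+ n) *ℚ constantTerm ((q , m′) ∷ reduce p)
      ∎
    where
    m′ = Vec.map (_% 2) m

-- The factors of the elementary algebraic expression

-- Each difference is 0 at a true variable and -2 at a false one. The product is thus -8 when all
-- three are false and 0 otherwise, and adding 8 yields 0 or 8.
eval-clauseFactor : ∀ {n} (x : Assignment n) (as : Vec (Fin n) 3) →
  eval x (clauseFactor as)
    ≡ 2^ (+ 3) *ℚ 𝟙 (does (any? (λ a → lookup x a Bool.≟ true) as))
eval-clauseFactor x (a ∷ b ∷ c ∷ []) = begin
  eval x (V a ⊗ V b ⊗ V c ⊕ con (fromℤ (+ 8)))
    ≡⟨ eval-⊕ x (V a ⊗ V b ⊗ V c) (con (fromℤ (+ 8))) ⟩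
  eval x (V a ⊗ V b ⊗ V c) + eval x (con (fromℤ (+ 8)))
    ≡⟨ cong₂ _+_
         (trans (eval-⊗ x (V a ⊗ V b) (V c))
           (cong₂ _*ℚ_ (trans (eval-⊗ x (V a) (V b)) (cong₂ _*ℚ_ (eval-V a) (eval-V b))) (eval-V c)))
         (eval-con x (fromℤ (+ 8))) ⟩
  v (lookup x a) *ℚ v (lookup x b) *ℚ v (lookup x c) + fromℤ (+ 8)
    ≡⟨ table (lookup x a) (lookup x b) (lookup x c) ⟩
  2^ (+ 3) *ℚ 𝟙 (does (any? (λ a → lookup x a Bool.≟ true) (a ∷ b ∷ c ∷ [])))
    ∎
  where
  V = λ a → var a ⊕ con (-ℚ 1ℚ)
  v = λ b → sign b + (-ℚ 1ℚ)
  eval-V : ∀ a → eval x (V a) ≡ v (lookup x a)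
  eval-V a = trans (eval-⊕ x (var a) (con (-ℚ 1ℚ))) (cong₂ _+_ (eval-var x a) (eval-con x (-ℚ 1ℚ)))
  table : ∀ a b c → v a *ℚ v b *ℚ v c + fromℤ (+ 8)
    ≡ 2^ (+ 3) *ℚ 𝟙 (does (any? (Bool._≟ true) (a ∷ b ∷ c ∷ [])))
  table true  true  true  = refl
  table true  true  false = refl
  table true  false true  = refl
  table true  false false = refl
  table false true  true  = refl
  table false true  false = refl
  table false false true  = refl
  table false false false = refl

-- The factor contributed to groupFactor by a literal when the group has value b.
literalValue : ∀ {n} → Assignment n → Bool → Literal n → ℚ
literalValue x b ℓ = sign b *ℚ (sign (positive ℓ) *ℚ sign (lookup x (variableOf ℓ))) + 1ℚ

-- Both products take the same form indexed by a Boolean, the common value of the group, so that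
-- `∏ᶠ-+` can expand the product over all groups.
eval-groupFactor : ∀ {n} (x : Assignment n) ℓs →
  eval x (groupFactor ℓs)
    ≡ product (map (literalValue x true) ℓs) + product (map (literalValue x false) ℓs)
eval-groupFactor {n} x ℓs = trans
  (eval-⊕ x (∏ (map P ℓs)) (∏ (map Q ℓs)))
  (cong₂ _+_ (trans (eval-∏-map x P ℓs) (cong product (List.map-cong eval-P ℓs)))
             (trans (eval-∏-map x Q ℓs) (cong product (List.map-cong eval-Q ℓs))))
  where
  P Q : Literal n → Poly n
  P ℓ = signed ℓ ⊕ con 1ℚ
  Q ℓ = con (-ℚ 1ℚ) ⊗ signed ℓ ⊕ con 1ℚ
  eval-signed : ∀ ℓ → eval x (signed ℓ) ≡ sign (positive ℓ) *ℚ sign (lookup x (variableOf ℓ))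
  eval-signed ℓ = trans (eval-⊗ x (con (sign (positive ℓ))) (var (variableOf ℓ)))
    (cong₂ _*ℚ_ (eval-con x (sign (positive ℓ))) (eval-var x (variableOf ℓ)))
  eval-P : ∀ ℓ → eval x (P ℓ) ≡ literalValue x true ℓ
  eval-P ℓ = trans (eval-⊕ x (signed ℓ) (con 1ℚ))
    -- A factor `sign true`, which is 1, is inserted to match the factor -1 of the other product.
    (cong₂ _+_ (trans (eval-signed ℓ) (sym (ℚ.*-identityˡ _))) (eval-con x 1ℚ))
  eval-Q : ∀ ℓ → eval x (Q ℓ) ≡ literalValue x false ℓ
  eval-Q ℓ = trans (eval-⊕ x (con (-ℚ 1ℚ) ⊗ signed ℓ) (con 1ℚ))
    (cong₂ _+_ (trans (eval-⊗ x (con (-ℚ 1ℚ)) (signed ℓ))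
                      (cong₂ _*ℚ_ (eval-con x (-ℚ 1ℚ)) (eval-signed ℓ)))
               (eval-con x 1ℚ))

-- The powers of two collect to one power, and a product of indicators is the indicator of the
-- conjunction.
∏ᶠ-all? : ∀ {A : Set} {P : Pred A 0ℓ} (P? : Decidable P) c {k} (as : Vec A k) →
  ∏ᶠ (λ i → 2^ (+ c) *ℚ 𝟙 (does (P? (lookup as i)))) ≡ 2^ (+ (k * c)) *ℚ 𝟙 (does (all? P? as))
∏ᶠ-all? P? c []           = refl
∏ᶠ-all? P? c {suc k} (a ∷ as) = begin
  2^ (+ c) *ℚ 𝟙 (does (P? a)) *ℚ ∏ᶠ (λ i → 2^ (+ c) *ℚ 𝟙 (does (P? (lookup as i))))
    ≡⟨ cong (2^ (+ c) *ℚ 𝟙 (does (P? a)) *ℚ_) (∏ᶠ-all? P? c as) ⟩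
  2^ (+ c) *ℚ 𝟙 (does (P? a)) *ℚ (2^ (+ (k * c)) *ℚ 𝟙 (does (all? P? as)))
    ≡⟨ *-interchange (2^ (+ c)) (𝟙 (does (P? a))) (2^ (+ (k * c))) (𝟙 (does (all? P? as))) ⟩
  2^ (+ c) *ℚ 2^ (+ (k * c)) *ℚ (𝟙 (does (P? a)) *ℚ 𝟙 (does (all? P? as)))
    ≡⟨ cong₂ _*ℚ_ (2^-+ c (k * c)) (𝟙-∧ (does (P? a)) (does (all? P? as))) ⟨
  2^ (+ (suc k * c)) *ℚ 𝟙 (does (all? P? (a ∷ as)))
    ∎

-- In the ±1 encoding, multiplication is logical equivalence.
sign-≟ : ∀ a b → sign (does (a Bool.≟ b)) ≡ sign a *ℚ sign b
sign-≟ true  true  = refl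
sign-≟ true  false = refl
sign-≟ false true  = refl
sign-≟ false false = refl

-- Summing the elementary algebraic expression of a formula

module _ {M N} (Φ : CNF M N) where

  holds? : ∀ σ → Decidable (Holds {N} σ)
  holds? σ ℓ = lookup σ (variableOf ℓ) Bool.≟ positive ℓ

  clauseValue groupValue : Assignment (M * 3) → ℚ
  clauseValue x = eval x (∏ (Vec.toList (Vec.map clauseFactor (newClauses (identityRelaxed Φ)))))
  groupValue  x = eval x (∏ (Vec.toList (Vec.map groupFactor (groups (identityRelaxed Φ)))))

  -- The coordinate at an occurrence is the value of the literal there, sign included, rather than
  -- that of its variable. This is the only ±1-point at which the summand of `σ` does not vanish.
  occurrenceValues : Assignment N → Assignment (M * 3)
  occurrenceValues σ = Vec.tabulate (λ a → does (holds? σ (occurrence Φ a)))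

  groupValue-expand : ∀ x → groupValue x ≡
    ∑ (λ σ → ∏ᶠ (λ a → sign (lookup (occurrenceValues σ) a) *ℚ sign (lookup x a) + 1ℚ))
  groupValue-expand x = begin
    groupValue x
      ≡⟨ eval-∏-tabulate x groupFactor (λ i → map newLiteral (occurrencesOf Φ i)) ⟩
    ∏ᶠ (λ i → eval x (groupFactor (map newLiteral (occurrencesOf Φ i))))
      ≡⟨ ∏ᶠ-cong (λ i → trans (eval-groupFactor x (map newLiteral (occurrencesOf Φ i)))
           (cong₂ _+_ (cong product (sym (List.map-∘ (occurrencesOf Φ i))))
                      (cong product (sym (List.map-∘ (occurrencesOf Φ i)))))) ⟩
    ∏ᶠ (λ i → product (map (h true) (occurrencesOf Φ i)) + product (map (h false) (occurrencesOf Φ i)))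
      ≡⟨ ∏ᶠ-+ (λ b i → product (map (h b) (occurrencesOf Φ i))) ⟩
    ∑ (λ σ → ∏ᶠ (λ i → product (map (h (lookup σ i)) (occurrencesOf Φ i))))
      -- The occurrences of the variables are the fibres of the map from occurrences to variables,
      -- so the double product becomes one over all occurrences.
      ≡⟨ ∑-cong (λ σ → ∏ᶠ-fibres (variableOf ∘ occurrence Φ) (λ i → h (lookup σ i)) (allFin (M * 3))) ⟩
    ∑ (λ σ → product (map (λ a → h (lookup σ (variableOf (occurrence Φ a))) a) (allFin (M * 3))))
      ≡⟨ ∑-cong (λ σ → product-allFin (λ a → h (lookup σ (variableOf (occurrence Φ a))) a)) ⟩
    ∑ (λ σ → ∏ᶠ (λ a → h (lookup σ (variableOf (occurrence Φ a))) a))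
      ≡⟨ ∑-cong (λ σ → ∏ᶠ-cong (λ a → cong (_+ 1ℚ) (agree σ a))) ⟩
    ∑ (λ σ → ∏ᶠ (λ a → sign (lookup (occurrenceValues σ) a) *ℚ sign (lookup x a) + 1ℚ))
      ∎
    where
    newLiteral : Fin (M * 3) → Literal (M * 3)
    newLiteral a = literal a (positive (occurrence Φ a))
    h : Bool → Fin (M * 3) → ℚ
    h b a = literalValue x b (newLiteral a)
    agree : ∀ σ a →
      sign (lookup σ (variableOf (occurrence Φ a))) *ℚ (sign (positive (occurrence Φ a)) *ℚ sign (lookup x a))
        ≡ sign (lookup (occurrenceValues σ) a) *ℚ sign (lookup x a)
    agree σ a = begin
      s *ℚ (e *ℚ sign (lookup x a))
        ≡⟨ ℚ.*-assoc s e (sign (lookup x a)) ⟨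
      s *ℚ e *ℚ sign (lookup x a)
        ≡⟨ cong (_*ℚ sign (lookup x a)) (sign-≟ (lookup σ (variableOf ℓ)) (positive ℓ)) ⟨
      sign (does (holds? σ ℓ)) *ℚ sign (lookup x a)
        ≡⟨ cong (λ b → sign b *ℚ sign (lookup x a)) (Vec.lookup∘tabulate (λ a → does (holds? σ (occurrence Φ a))) a) ⟨
      sign (lookup (occurrenceValues σ) a) *ℚ sign (lookup x a)
        ∎
      where
      ℓ = occurrence Φ a
      s = sign (lookup σ (variableOf ℓ))
      e = sign (positive ℓ)

  -- At this point the new variable at position `combine c j` has the truth value of the `j`-th
  -- literal of clause `c`. Hence each new clause agrees with the original one and contributes 8 or
  -- 0.
  clauseValue-occurrenceValues : ∀ σ →
    clauseValue (occurrenceValues σ) ≡ 2^ (+ (M * 3)) *ℚ 𝟙 (does (satisfies? Φ σ))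
  clauseValue-occurrenceValues σ = begin
    clauseValue y
      ≡⟨ eval-∏-tabulate y clauseFactor (λ (c : Fin M) → Vec.tabulate (combine c)) ⟩
    ∏ᶠ {M} (λ c → eval y (clauseFactor (Vec.tabulate (combine c))))
      ≡⟨ ∏ᶠ-cong (λ (c : Fin M) → trans (eval-clauseFactor y (Vec.tabulate (combine c)))
           (cong (λ b → 2^ (+ 3) *ℚ 𝟙 b) (clause c))) ⟩
    ∏ᶠ (λ c → 2^ (+ 3) *ℚ 𝟙 (does (any? (holds? σ) (lookup (clauses Φ) c))))
      ≡⟨ ∏ᶠ-all? (any? (holds? σ)) 3 (clauses Φ) ⟩
    2^ (+ (M * 3)) *ℚ 𝟙 (does (satisfies? Φ σ))
      ∎
    where
    y = occurrenceValues σ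
    ≟-true : ∀ b → does (b Bool.≟ true) ≡ b
    ≟-true true  = refl
    ≟-true false = refl
    literal-holds : ∀ c j →
      does (lookup y (combine c j) Bool.≟ true) ≡ does (holds? σ (lookup (lookup (clauses Φ) c) j))
    literal-holds c j = begin
      does (lookup y (combine c j) Bool.≟ true)
        ≡⟨ ≟-true _ ⟩
      lookup y (combine c j)
        ≡⟨ Vec.lookup∘tabulate (λ a → does (holds? σ (occurrence Φ a))) (combine c j) ⟩
      does (holds? σ (occurrence Φ (combine c j)))
        ≡⟨ cong (does ∘ holds? σ) (Vec.lookup-concat (clauses Φ) c j) ⟩
      does (holds? σ (lookup (lookup (clauses Φ) c) j))
        ∎
    -- Only the Boolean results are compared, as the two `Any` predicates range over different
    -- types.
    does-any? : ∀ {A B : Set} {P : Pred A 0ℓ} {Q : Pred B 0ℓ} (P? : Decidable P) (Q? : Decidable Q)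
      {k} (f : Fin k → A) (bs : Vec B k) → (∀ j → does (P? (f j)) ≡ does (Q? (lookup bs j))) →
      does (any? P? (Vec.tabulate f)) ≡ does (any? Q? bs)
    does-any? P? Q? f []       eq = refl
    does-any? P? Q? f (b ∷ bs) eq = cong₂ _∨_ (eq zero) (does-any? P? Q? (f ∘ suc) bs (eq ∘ suc))
    clause : ∀ c → does (any? (λ a → lookup y a Bool.≟ true) (Vec.tabulate (combine c)))
                 ≡ does (any? (holds? σ) (lookup (clauses Φ) c))
    clause c = does-any? (λ a → lookup y a Bool.≟ true) (holds? σ) (combine c) (lookup (clauses Φ) c) (literal-holds c)

  -- Once the sums are exchanged, `∑-delta` collapses the inner sum to the single point of `σ`. One
  -- factor `T` comes from this collapse and the other from the clause factors.
  ∑-clauseValue-groupValue :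
    ∑ (λ x → clauseValue x *ℚ groupValue x) ≡ 2^ (+ (6 * M)) *ℚ fromℤ (+ #satisfying Φ)
  ∑-clauseValue-groupValue = begin
    ∑ (λ x → clauseValue x *ℚ groupValue x)
      ≡⟨ ∑-cong (λ x → trans (cong (clauseValue x *ℚ_) (groupValue-expand x)) (sym (∑-*ˡ (clauseValue x) (δ x)))) ⟩
    ∑ (λ x → ∑ (λ σ → clauseValue x *ℚ δ x σ))
      ≡⟨ ∑-swap (λ x σ → clauseValue x *ℚ δ x σ) ⟩
    ∑ (λ σ → ∑ (λ x → clauseValue x *ℚ δ x σ))
      ≡⟨ ∑-cong (λ σ → trans (∑-delta clauseValue (occurrenceValues σ)) (cong (T *ℚ_) (clauseValue-occurrenceValues σ))) ⟩
    ∑ (λ σ → T *ℚ (T *ℚ 𝟙 (does (satisfies? Φ σ))))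
      ≡⟨ trans (∑-*ˡ T (λ σ → T *ℚ 𝟙 (does (satisfies? Φ σ)))) (cong (T *ℚ_) (∑-*ˡ T (λ σ → 𝟙 (does (satisfies? Φ σ))))) ⟩
    T *ℚ (T *ℚ ∑ (λ σ → 𝟙 (does (satisfies? Φ σ))))
      ≡⟨ ℚ.*-assoc T T _ ⟨
    T *ℚ T *ℚ ∑ (λ σ → 𝟙 (does (satisfies? Φ σ)))
      ≡⟨ cong₂ _*ℚ_ (2^-+ (M * 3) (M * 3)) (#-as-∑ N (satisfies? Φ)) ⟨
    2^ (+ (M * 3 ℕ.+ M * 3)) *ℚ fromℤ (+ #satisfying Φ)
      ≡⟨ cong (λ k → 2^ (+ k) *ℚ fromℤ (+ #satisfying Φ)) exponent ⟩
    2^ (+ (6 * M)) *ℚ fromℤ (+ #satisfying Φ)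
      ∎
    where
    T = 2^ (+ (M * 3))
    δ : Assignment (M * 3) → Assignment N → ℚ
    δ x σ = ∏ᶠ (λ a → sign (lookup (occurrenceValues σ) a) *ℚ sign (lookup x a) + 1ℚ)
    exponent : M * 3 ℕ.+ M * 3 ≡ 6 * M
    exponent = trans (sym (ℕ.*-distribˡ-+ M 3 3)) (ℕ.*-comm M 6)

  ∑-elementaryExpression :
    ∑ (λ x → eval x (elementaryExpression (identityRelaxed Φ)))
      ≡ fromℤ (+ (2 * #satisfying Φ)) - 2^ (+ (M * 3))
  ∑-elementaryExpression = begin
    ∑ (λ x → eval x (elementaryExpression (identityRelaxed Φ)))
      ≡⟨ ∑-cong expand ⟩
    ∑ (λ x → K *ℚ (clauseValue x *ℚ groupValue x) + (-ℚ 1ℚ))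
      ≡⟨ ∑-+ (λ x → K *ℚ (clauseValue x *ℚ groupValue x)) (λ _ → -ℚ 1ℚ) ⟩
    ∑ (λ x → K *ℚ (clauseValue x *ℚ groupValue x)) + ∑ {M * 3} (λ _ → -ℚ 1ℚ)
      ≡⟨ cong₂ _+_ (trans (∑-*ˡ K (λ x → clauseValue x *ℚ groupValue x)) (cong (K *ℚ_) ∑-clauseValue-groupValue))
                   (trans (∑-const (M * 3) (-ℚ 1ℚ)) (ℚ.*-comm (2^ (+ (M * 3))) (-ℚ 1ℚ))) ⟩
    K *ℚ (2^ (+ (6 * M)) *ℚ k) + (-ℚ 1ℚ) *ℚ 2^ (+ (M * 3))
      ≡⟨ cong₂ _+_ scale (-1*x≈-x (2^ (+ (M * 3)))) ⟩
    fromℤ (+ (2 * #satisfying Φ)) - 2^ (+ (M * 3))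
      ∎
    where
    K = 2^ (1 ⊖ 6 * M)
    k = fromℤ (+ #satisfying Φ)
    C = ∏ (Vec.toList (Vec.map clauseFactor (newClauses (identityRelaxed Φ))))
    G = ∏ (Vec.toList (Vec.map groupFactor (groups (identityRelaxed Φ))))
    expand : ∀ x → eval x (elementaryExpression (identityRelaxed Φ))
                 ≡ K *ℚ (clauseValue x *ℚ groupValue x) + (-ℚ 1ℚ)
    expand x = trans (eval-⊕ x (con K ⊗ C ⊗ G) (con (-ℚ 1ℚ))) (cong₂ _+_
      (begin
        eval x (con K ⊗ C ⊗ G)                    ≡⟨ eval-⊗ x (con K ⊗ C) G ⟩
        eval x (con K ⊗ C) *ℚ groupValue x        ≡⟨ cong (_*ℚ groupValue x) (eval-⊗ x (con K) C) ⟩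
        eval x (con K) *ℚ clauseValue x *ℚ groupValue x ≡⟨ cong (λ q → q *ℚ clauseValue x *ℚ groupValue x) (eval-con x K) ⟩
        K *ℚ clauseValue x *ℚ groupValue x        ≡⟨ ℚ.*-assoc K (clauseValue x) (groupValue x) ⟩
        K *ℚ (clauseValue x *ℚ groupValue x)      ∎)
      (eval-con x (-ℚ 1ℚ)))
    scale : K *ℚ (2^ (+ (6 * M)) *ℚ k) ≡ fromℤ (+ (2 * #satisfying Φ))
    scale = begin
      K *ℚ (2^ (+ (6 * M)) *ℚ k)   ≡⟨ ℚ.*-assoc K (2^ (+ (6 * M))) k ⟨
      -- The leading factor cancels all but one factor 2, which becomes the 2 in front of the number
      -- of satisfying assignments.
      K *ℚ 2^ (+ (6 * M)) *ℚ k     ≡⟨ cong (_*ℚ k) (2^-⊖ 1 (6 * M)) ⟩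
      fromℤ (+ 2) *ℚ k             ≡⟨ solve 1 (λ k → κ (fromℤ (+ 2)) :* k := k :+ k) refl k ⟩
      k + k                        ≡⟨ fromℤ-+ (+ #satisfying Φ) (+ #satisfying Φ) ⟨
      fromℤ (+ (#satisfying Φ ℕ.+ #satisfying Φ)) ≡⟨ cong (λ j → fromℤ (+ (#satisfying Φ ℕ.+ j))) (ℕ.+-identityʳ (#satisfying Φ)) ⟨
      fromℤ (+ (2 * #satisfying Φ)) ∎

theorem11 : ∀ (M N : ℕ) (Φ : CNF M N) →
    constantTerm (reducedElementaryExpression (identityRelaxed Φ))
    ≡ 2^ (- (+ (3 * M))) *ℚ (fromℤ (+ (2 * #satisfying Φ)) - 2^ (+ (3 * M)))
theorem11 M N Φ = begin
  c
    ≡⟨ ℚ.*-identityˡ c ⟨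
  1ℚ *ℚ c
    -- The factor 1 is split as a power of two times its inverse, so that `∑-eval` can turn the
    -- positive power times `c` into a sum over points.
    ≡⟨ cong (_*ℚ c) (2^-⊖ 0 (3 * M)) ⟨
  2^ (0 ⊖ 3 * M) *ℚ 2^ (+ (3 * M)) *ℚ c
    ≡⟨ ℚ.*-assoc (2^ (0 ⊖ 3 * M)) (2^ (+ (3 * M))) c ⟩
  2^ (0 ⊖ 3 * M) *ℚ (2^ (+ (3 * M)) *ℚ c)
    -- The number of variables is `M * 3`, as `combine` dictates, whereas the statement has `3 * M`.
    ≡⟨ cong₂ (λ z k → 2^ z *ℚ (2^ (+ k) *ℚ c)) (ℤ.⊖-swap 0 (3 * M)) (ℕ.*-comm 3 M) ⟩
  2^ (- (+ (3 * M))) *ℚ (2^ (+ (M * 3)) *ℚ c)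
    ≡⟨ cong (2^ (- (+ (3 * M))) *ℚ_) (∑-eval (elementaryExpression (identityRelaxed Φ))) ⟨
  2^ (- (+ (3 * M))) *ℚ ∑ (λ x → eval x (elementaryExpression (identityRelaxed Φ)))
    ≡⟨ cong (2^ (- (+ (3 * M))) *ℚ_) (∑-elementaryExpression Φ) ⟩
  2^ (- (+ (3 * M))) *ℚ (fromℤ (+ (2 * #satisfying Φ)) - 2^ (+ (M * 3)))
    ≡⟨ cong (λ k → 2^ (- (+ (3 * M))) *ℚ (fromℤ (+ (2 * #satisfying Φ)) - 2^ (+ k))) (ℕ.*-comm M 3) ⟩
  2^ (- (+ (3 * M))) *ℚ (fromℤ (+ (2 * #satisfying Φ)) - 2^ (+ (3 * M)))
    ∎
  where
  c = constantTerm (reducedElementaryExpression (identityRelaxed Φ))
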